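{- Let $\Gamma = (V,E)$ be a finite connected simple graph. Then $\Gamma$ is slide-equivalent to an almost regular graph.
   Context: A simple graph has no loops and no double edges; write $x \sim y$ if the vertices $x,y$ are joined by an edge $\overline{xy}$, and $d(x)$ for the degree of a vertex $x$. An (edge) slide on a graph $(V,E)$ is the following operation: given three distinct vertices $x,y,z \in V$ with $x \sim y \sim z$ and $x \not\sim z$, replace the edge $\overline{xy}$ by the edge $\overline{xz}$, so that the new graph is $(V, (E \setminus \{\overline{xy}\}) \cup \{\overline{xz}\})$. Two graphs $\Gamma$ and $\Sigma$ are slide-equivalent if there exists a finite (possibly empty) sequence of edge slides in $\Gamma$ which yields a graph $\widetilde{\Gamma}$ isomorphic to $\Sigma$. A graph with vertex set $V$ is almost regular if $\max_{x,y \in V} |d(x) - d(y)| \leq 1$. -}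

module Defs where

open import Level using (0ℓ)
open import Data.Nat.Base using (ℕ; _≤_; ∣_-_∣)
open import Data.Fin.Base using (Fin)
open import Data.Vec.Base using (count; allFin)
open import Data.Product.Base using (_×_; _,_; Σ-syntax; ∃-syntax)
open import Data.Sum.Base using (_⊎_)
open import Function.Bundles using (_⇔_; _↔_; Inverse)
open import Relation.Nullary.Negation.Core using (¬_)
open import Relation.Binary.Core using (Rel)
open import Relation.Binary.Definitions using (Decidable; Symmetric; Irreflexive)
open import Relation.Binary.PropositionalEquality.Core using (_≡_; _≢_)
open import Relation.Binary.Construct.Closure.ReflexiveTransitive using (Star)

-- Finite simple graphs with vertex set Fin n.  The edge set is given by its
-- adjacency relation, which only matters up to _⇔_ : distinct proofs of x ~ y
-- are not distinct edges.
record Graph (n : ℕ) : Set₁ where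
  field
    _~_    : Rel (Fin n) 0ℓ
    _~?_   : Decidable _~_
    sym    : Symmetric _~_
    irrefl : Irreflexive _≡_ _~_

  degree : Fin n → ℕ
  degree x = count (x ~?_) (allFin n)

  -- The empty graph (n = 0) counts as connected.
  Connected : Set
  Connected = ∀ x y → Star _~_ x y

  AlmostRegular : Set
  AlmostRegular = ∀ x y → ∣ degree x - degree y ∣ ≤ 1

open Graph public using (Connected; AlmostRegular)

-- Equality of unordered pairs.
_≈ₑ_ : ∀ {n} → Rel (Fin n × Fin n) 0ℓ
(u , v) ≈ₑ (x , y) = (u ≡ x × v ≡ y) ⊎ (u ≡ y × v ≡ x)

-- SlideAt Γ Δ x y z : Δ is the graph obtained from Γ by replacing the edge xy
-- with xz.
record SlideAt {n} (Γ Δ : Graph n) (x y z : Fin n) : Set where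
  open Graph Γ using (_~_)
  open Graph Δ using () renaming (_~_ to _~′_)
  field
    x≢y    : x ≢ y
    y≢z    : y ≢ z
    x≢z    : x ≢ z
    x~y    : x ~ y
    y~z    : y ~ z
    x≁z    : ¬ (x ~ z)
    result : ∀ u v → (u ~′ v) ⇔
             ((u ~ v × ¬ ((u , v) ≈ₑ (x , y))) ⊎ ((u , v) ≈ₑ (x , z)))

Slide : ∀ {n} → Graph n → Graph n → Set
Slide Γ Δ = ∃[ x ] ∃[ y ] ∃[ z ] SlideAt Γ Δ x y z

record Isomorphic {m n} (Γ : Graph m) (Δ : Graph n) : Set where
  open Graph Γ using (_~_)
  open Graph Δ using () renaming (_~_ to _~′_)
  field
    bijection : Fin m ↔ Fin n
  open Inverse bijection using (to)
  field
    preserves : ∀ x y → (x ~ y) ⇔ (to x ~′ to y)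

SlideEquivalent : ∀ {m n} → Graph m → Graph n → Set₁
SlideEquivalent {m} Γ Δ = Σ[ Γ̃ ∈ Graph m ] (Star Slide Γ Γ̃ × Isomorphic Γ̃ Δ)

{-# OPTIONS --safe #-}
-- Sliding an edge from y to a neighbour z of smaller degree moves one unit of
-- degree from y to z, and such a slide is always available: y has more
-- neighbours than z.  If deg y ≥ deg z + 2, it lowers the sum of the squared
-- degrees.  If y and z with deg y ≥ deg z + 2 are not adjacent, slide from y to
-- the next vertex v of a walk from y to z, provided deg y > deg v (otherwise
-- start from v instead): when deg y = deg v + 1, this swaps the degrees of y
-- and v, hence keeps the sum of squares, and leaves a shorter walk to z from a
-- vertex whose degree exceeds that of z by at least 2.
module Submission where

open import Defs
open import Data.Nat.Base using (ℕ; zero; suc; _+_; _*_; _≤_; _<_; ∣_-_∣; z≤n; s≤s; s≤s⁻¹)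
open import Data.Nat.Properties using (+-*-semiring; +-mono-≤; +-monoʳ-<; *-monoʳ-<; +-cancelʳ-≡; +-cancelˡ-≡; +-cancelʳ-<; +-comm; +-suc; +-identityʳ; *-identityʳ; ≤-refl; ≤-trans; ≤-antisym; ≰⇒>; m≤m+n; m≤n+m; 1+n≰n; _≤?_; suc-injective; module ≤-Reasoning)
open import Data.Nat.Induction using (<-wellFounded)
open import Data.Nat.Tactic.RingSolver using (solve-∀)
open import Algebra.Properties.Semiring.Sum +-*-semiring using (sum; sum-syntax; sum-cong-≗; sum-replicate-zero; ∑-distrib-+)
open import Data.Bool.Base using (true; false; if_then_else_)
open import Data.Fin.Base using (Fin; zero; suc)
open import Data.Fin.Properties using (_≟_; any?)
open import Data.Product.Base using (_×_; _,_; Σ-syntax; ∃-syntax)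
open import Data.Sum.Base using (_⊎_; inj₁; inj₂)
open import Data.Vec.Base using (count; tabulate)
open import Function.Base using (id; _∘_)
open import Function.Construct.Identity using (↔-id; ⇔-id)
open import Induction.WellFounded using (Acc; acc)
open import Level using (0ℓ)
open import Relation.Binary.Construct.Closure.ReflexiveTransitive using (Star; ε; _◅_; _◅◅_; kleisliStar)
open import Relation.Binary.Definitions using (Decidable)
open import Relation.Binary.PropositionalEquality using (_≡_; _≢_; refl; sym; trans; cong; cong₂; subst; module ≡-Reasoning)
open import Relation.Nullary.Decidable using (Dec; yes; no; does; ¬?; _×-dec_; _⊎-dec_; dec-true; dec-false)
open import Relation.Nullary.Negation using (¬_; contradiction)
import Relation.Unary as Unary

-- Indicators and finite sums.

-- Going through `does` lets indicators of compound decisions, and of equality in `Fin`, reduce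
-- without inspecting proofs.
𝟙 : ∀ {P : Set} → Dec P → ℕ
𝟙 P? = if does P? then 1 else 0

module _ {P : Set} (P? : Dec P) where

  𝟙-true : P → 𝟙 P? ≡ 1
  𝟙-true p = cong (if_then 1 else 0) (dec-true P? p)

  𝟙-false : ¬ P → 𝟙 P? ≡ 0
  𝟙-false ¬p = cong (if_then 1 else 0) (dec-false P? ¬p)

𝟙≤1 : ∀ {P : Set} (P? : Dec P) → 𝟙 P? ≤ 1
𝟙≤1 (yes _) = ≤-refl
𝟙≤1 (no _)  = z≤n

-- Since `Q` implies `P`, removing `Q` costs exactly its indicator; since `R` excludes `P`, adding
-- `R` counts nothing twice. The additive form avoids truncated subtraction.
𝟙-exchange : ∀ {P Q R : Set} (P? : Dec P) (Q? : Dec Q) (R? : Dec R) → (Q → P) → (R → ¬ P) →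
             𝟙 ((P? ×-dec ¬? Q?) ⊎-dec R?) + 𝟙 Q? ≡ 𝟙 P? + 𝟙 R?
𝟙-exchange (yes p) _       (yes r) _   R⇒¬P = contradiction p (R⇒¬P r)
𝟙-exchange (no ¬p) (yes q) _       Q⇒P _    = contradiction (Q⇒P q) ¬p
𝟙-exchange (yes _) (yes _) (no _)  _   _    = refl
𝟙-exchange (yes _) (no _)  (no _)  _   _    = refl
𝟙-exchange (no _)  (no _)  (yes _) _   _    = refl
𝟙-exchange (no _)  (no _)  (no _)  _   _    = refl

count-tabulate : ∀ {A : Set} {P : Unary.Pred A 0ℓ} (P? : Unary.Decidable P) {n} (f : Fin n → A) →
                 count P? (tabulate f) ≡ ∑[ i < n ] 𝟙 (P? (f i))
count-tabulate P? {zero}  f = refl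
count-tabulate P? {suc n} f with does (P? (f zero))
... | true  = cong suc (count-tabulate P? (f ∘ suc))
... | false = count-tabulate P? (f ∘ suc)

∑-mono-≤ : ∀ {n} {f g : Fin n → ℕ} → (∀ i → f i ≤ g i) → sum f ≤ sum g
∑-mono-≤ {zero}  f≤g = z≤n
∑-mono-≤ {suc n} f≤g = +-mono-≤ (f≤g zero) (∑-mono-≤ (f≤g ∘ suc))

∑-𝟙-* : ∀ {n} (j : Fin n) (f : Fin n → ℕ) → ∑[ i < n ] (𝟙 (i ≟ j) * f i) ≡ f j
∑-𝟙-* {suc n} zero    f = begin
  f zero + 0 + ∑[ i < n ] 0 ≡⟨ cong₂ _+_ (+-identityʳ _) (sum-replicate-zero n) ⟩
  f zero + 0                ≡⟨ +-identityʳ _ ⟩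
  f zero                    ∎
  where open ≡-Reasoning
∑-𝟙-* {suc n} (suc j) f = ∑-𝟙-* j (f ∘ suc)

∑-𝟙 : ∀ {n} (j : Fin n) → ∑[ i < n ] 𝟙 (i ≟ j) ≡ 1
∑-𝟙 j = trans (sum-cong-≗ (λ i → sym (*-identityʳ (𝟙 (i ≟ j))))) (∑-𝟙-* j (λ _ → 1))

-- Incidence of a vertex with an edge.

module _ {n : ℕ} where

  _≈ₑ?_ : Decidable (_≈ₑ_ {n})
  (u , v) ≈ₑ? (x , y) = (u ≟ x ×-dec v ≟ y) ⊎-dec (u ≟ y ×-dec v ≟ x)

  ≈ₑ-swap : {u v x y : Fin n} → (u , v) ≈ₑ (x , y) → (v , u) ≈ₑ (x , y)
  ≈ₑ-swap (inj₁ (p , q)) = inj₂ (q , p)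
  ≈ₑ-swap (inj₂ (p , q)) = inj₁ (q , p)

  -- The two orientations exclude each other because `x ≢ y`, so the disjunction becomes a sum. The
  -- factor in `v` comes first to match `∑-𝟙-*`.
  𝟙-≈ₑ : ∀ {x y : Fin n} → x ≢ y → ∀ u v →
         𝟙 ((u , v) ≈ₑ? (x , y)) ≡ 𝟙 (v ≟ y) * 𝟙 (u ≟ x) + 𝟙 (v ≟ x) * 𝟙 (u ≟ y)
  𝟙-≈ₑ {x} {y} x≢y u v with u ≟ x | v ≟ y | u ≟ y | v ≟ x
  ... | yes refl | _        | yes refl | _        = contradiction refl x≢y
  ... | _        | yes refl | _        | yes refl = contradiction refl x≢y
  ... | yes _    | yes _    | no _     | no _     = refl
  ... | yes _    | no _     | no _     | yes _    = refl
  ... | yes _    | no _     | no _     | no _     = refl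
  ... | no _     | yes _    | yes _    | no _     = refl
  ... | no _     | yes _    | no _     | no _     = refl
  ... | no _     | no _     | yes _    | yes _    = refl
  ... | no _     | no _     | yes _    | no _     = refl
  ... | no _     | no _     | no _     | yes _    = refl
  ... | no _     | no _     | no _     | no _     = refl

  ∑-𝟙-≈ₑ : ∀ {x y : Fin n} → x ≢ y → ∀ u →
           ∑[ v < n ] 𝟙 ((u , v) ≈ₑ? (x , y)) ≡ 𝟙 (u ≟ x) + 𝟙 (u ≟ y)
  ∑-𝟙-≈ₑ {x} {y} x≢y u = begin
    ∑[ v < n ] 𝟙 ((u , v) ≈ₑ? (x , y))
      ≡⟨ sum-cong-≗ (𝟙-≈ₑ x≢y u) ⟩
    ∑[ v < n ] (𝟙 (v ≟ y) * 𝟙 (u ≟ x) + 𝟙 (v ≟ x) * 𝟙 (u ≟ y))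
      ≡⟨ ∑-distrib-+ {n} _ _ ⟩
    ∑[ v < n ] (𝟙 (v ≟ y) * 𝟙 (u ≟ x)) + ∑[ v < n ] (𝟙 (v ≟ x) * 𝟙 (u ≟ y))
      ≡⟨ cong₂ _+_ (∑-𝟙-* y _) (∑-𝟙-* x _) ⟩
    𝟙 (u ≟ x) + 𝟙 (u ≟ y) ∎
    where open ≡-Reasoning

-- Degrees, the potential and the edge to slide.

open Graph using (degree)

degree≡∑ : ∀ {n} (Γ : Graph n) u → degree Γ u ≡ ∑[ v < n ] 𝟙 (Graph._~?_ Γ u v)
degree≡∑ Γ u = count-tabulate (Graph._~?_ Γ u) id

potential : ∀ {n} → Graph n → ℕ
potential {n} Γ = ∑[ u < n ] (degree Γ u * degree Γ u)

-- Otherwise the neighbours of `y` other than `z` would all be neighbours of `z` other than `y`. As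
-- `y` and `z` are adjacent, counting would give `deg y ≤ deg z`.
private-neighbour : ∀ {n} (Γ : Graph n) {y z} → Graph._~_ Γ y z → degree Γ z < degree Γ y →
                    ∃[ x ] Graph._~_ Γ x y × x ≢ z × ¬ Graph._~_ Γ x z
private-neighbour {n} Γ {y} {z} y~z dz<dy
  with any? (λ x → (x ~? y) ×-dec ¬? (x ≟ z) ×-dec ¬? (x ~? z))
  where open Graph Γ using (_~?_)
... | yes found = found
... | no  none  = contradiction (≤-trans dz<dy dy≤dz) (1+n≰n)
  where
  open Graph Γ using (_~_; _~?_; irrefl) renaming (sym to ~-sym; degree to deg)

  -- The summands 𝟙 (x ≟ y) and 𝟙 (x ≟ z) absorb the edge yz itself.
  bound : ∀ x → 𝟙 (y ~? x) + 𝟙 (x ≟ y) ≤ 𝟙 (z ~? x) + 𝟙 (x ≟ z)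
  bound x with x ≟ y | x ≟ z
  ... | yes refl | _ rewrite 𝟙-false (x ~? x) (irrefl refl) | 𝟙-true (z ~? x) (~-sym y~z) = m≤m+n 1 _
  ... | no _ | yes refl rewrite +-identityʳ (𝟙 (y ~? x)) = ≤-trans (𝟙≤1 (y ~? x)) (m≤n+m 1 _)
  ... | no _ | no x≢z with y ~? x | z ~? x
  ...   | no _    | _       = z≤n
  ...   | yes _   | yes _   = ≤-refl
  ...   | yes y~x | no z≁x  = contradiction (x , ~-sym y~x , x≢z , z≁x ∘ ~-sym) none

  dy≤dz : deg y ≤ deg z
  dy≤dz = s≤s⁻¹ (begin
    suc (deg y)                                     ≡⟨ +-comm 1 _ ⟩
    deg y + 1                                       ≡⟨ cong₂ _+_ (degree≡∑ Γ y) (sym (∑-𝟙 y)) ⟩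
    ∑[ x < n ] 𝟙 (y ~? x) + ∑[ x < n ] 𝟙 (x ≟ y)    ≡⟨ ∑-distrib-+ {n} _ _ ⟨
    ∑[ x < n ] (𝟙 (y ~? x) + 𝟙 (x ≟ y))             ≤⟨ ∑-mono-≤ bound ⟩
    ∑[ x < n ] (𝟙 (z ~? x) + 𝟙 (x ≟ z))             ≡⟨ ∑-distrib-+ {n} _ _ ⟩
    ∑[ x < n ] 𝟙 (z ~? x) + ∑[ x < n ] 𝟙 (x ≟ z)    ≡⟨ cong₂ _+_ (sym (degree≡∑ Γ z)) (∑-𝟙 z) ⟩
    deg z + 1                                       ≡⟨ +-comm _ 1 ⟩
    suc (deg z)                                     ∎)
    where open ≤-Reasoning

-- Walks of bounded length.

-- The first index is an upper bound for the length.
data Walk {n} (Γ : Graph n) : ℕ → Fin n → Fin n → Set where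
  []  : ∀ {k u} → Walk Γ k u u
  _∷_ : ∀ {k u v w} → Graph._~_ Γ u v → Walk Γ k v w → Walk Γ (suc k) u w

weaken : ∀ {n} {Γ : Graph n} {k u v} → Walk Γ k u v → Walk Γ (suc k) u v
weaken []      = []
weaken (e ∷ p) = e ∷ weaken p

fromStar : ∀ {n} {Γ : Graph n} {u v} → Star (Graph._~_ Γ) u v → ∃[ k ] Walk Γ k u v
fromStar ε       = 0 , []
fromStar (e ◅ p) = let k , w = fromStar p in suc k , e ∷ w

-- The slide and its effect on connectivity, walks, degrees and potential.

module _ {n} (Γ : Graph n) (x y z : Fin n) (x≢z : x ≢ z) where
  open Graph Γ using (_~_; _~?_; irrefl) renaming (sym to ~-sym)

  slide : Graph n
  slide = record
    { _~_    = λ u v → (u ~ v × ¬ ((u , v) ≈ₑ (x , y))) ⊎ ((u , v) ≈ₑ (x , z))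
    ; _~?_   = λ u v → ((u ~? v) ×-dec ¬? ((u , v) ≈ₑ? (x , y))) ⊎-dec ((u , v) ≈ₑ? (x , z))
    ; sym    = λ where
        (inj₁ (u~v , ≉)) → inj₁ (~-sym u~v , ≉ ∘ ≈ₑ-swap)
        (inj₂ ≈)         → inj₂ (≈ₑ-swap ≈)
    ; irrefl = λ where
        refl (inj₁ (u~u , _))           → irrefl refl u~u
        refl (inj₂ (inj₁ (refl , u≡z))) → x≢z u≡z
        refl (inj₂ (inj₂ (u≡z , refl))) → x≢z u≡z
    }

module _ {n} (Γ : Graph n) {x y z : Fin n} (x~y : Graph._~_ Γ x y) (y~z : Graph._~_ Γ y z)
         (x≢z : x ≢ z) (x≁z : ¬ Graph._~_ Γ x z) where

  open Graph Γ using (_~_; _~?_; irrefl) renaming (sym to ~-sym; degree to deg)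

  private
    Γ′ = slide Γ x y z x≢z
    open Graph Γ′ using () renaming (_~_ to _~′_; _~?_ to _~′?_; sym to ~′-sym; degree to degree′)

    ~⇒≢ : ∀ {u v} → u ~ v → u ≢ v
    ~⇒≢ u~v refl = irrefl refl u~v

  slide-slides : Slide Γ Γ′
  slide-slides = x , y , z , record
    { x≢y = ~⇒≢ x~y ; y≢z = ~⇒≢ y~z ; x≢z = x≢z
    ; x~y = x~y ; y~z = y~z ; x≁z = x≁z
    ; result = λ u v → ⇔-id _
    }

  -- The only lost edge, between `x` and `y`, is bypassed through `z`: the new edge joins `x` to
  -- `z`, and the edge from `y` to `z` survives.
  slide-connected : Connected Γ → Connected Γ′
  slide-connected conn u v = kleisliStar id reroute (conn u v)
    where
    x~′z : x ~′ z
    x~′z = inj₂ (inj₁ (refl , refl))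

    y~′z : y ~′ z
    y~′z = inj₁ (y~z , λ where
      (inj₁ (y≡x , _)) → ~⇒≢ x~y (sym y≡x)
      (inj₂ (_ , z≡x)) → x≢z (sym z≡x))

    reroute : ∀ {u v} → u ~ v → Star _~′_ u v
    reroute {u} {v} u~v with (u , v) ≈ₑ? (x , y)
    ... | no ≉                    = inj₁ (u~v , ≉) ◅ ε
    ... | yes (inj₁ (refl , refl)) = x~′z ◅ ~′-sym y~′z ◅ ε
    ... | yes (inj₂ (refl , refl)) = y~′z ◅ ~′-sym x~′z ◅ ε

  -- The lost edge ends at `y`, so a walk that avoids `y` survives; a walk that meets `y` has a tail
  -- starting there. Carrying `u ≢ y` shows that each edge kept has neither end at `y`.
  slide-walk : ∀ {k u w} → Walk Γ k u w → Walk Γ k y w ⊎ (u ≢ y × Walk Γ′ k u w)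
  slide-walk {u = u} p with u ≟ y
  slide-walk p       | yes refl = inj₁ p
  slide-walk []      | no u≢y   = inj₂ (u≢y , [])
  slide-walk (e ∷ p) | no u≢y with slide-walk p
  ... | inj₁ q         = inj₁ (weaken q)
  ... | inj₂ (v≢y , q) = inj₂ (u≢y , inj₁ (e , λ where
    (inj₁ (_ , v≡y)) → v≢y v≡y
    (inj₂ (u≡y , _)) → u≢y u≡y) ∷ q)

  slide-𝟙 : ∀ u v → 𝟙 (u ~′? v) + 𝟙 ((u , v) ≈ₑ? (x , y)) ≡ 𝟙 (u ~? v) + 𝟙 ((u , v) ≈ₑ? (x , z))
  slide-𝟙 u v = 𝟙-exchange (u ~? v) ((u , v) ≈ₑ? (x , y)) ((u , v) ≈ₑ? (x , z))
    (λ where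
      (inj₁ (refl , refl)) → x~y
      (inj₂ (refl , refl)) → ~-sym x~y)
    (λ where
      (inj₁ (refl , refl)) → x≁z
      (inj₂ (refl , refl)) → x≁z ∘ ~-sym)

  -- Sum `slide-𝟙` over `v`. The vertex `x` loses one edge and gains another, so its indicator
  -- occurs on both sides and cancels.
  slide-degree : ∀ u → degree′ u + 𝟙 (u ≟ y) ≡ deg u + 𝟙 (u ≟ z)
  slide-degree u = +-cancelˡ-≡ (𝟙 (u ≟ x)) _ _ (begin
    𝟙 (u ≟ x) + (degree′ u + 𝟙 (u ≟ y))
      ≡⟨ rearrange (𝟙 (u ≟ x)) (degree′ u) _ ⟩
    degree′ u + (𝟙 (u ≟ x) + 𝟙 (u ≟ y))
      ≡⟨ cong₂ _+_ (degree≡∑ Γ′ u) (sym (∑-𝟙-≈ₑ (~⇒≢ x~y) u)) ⟩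
    ∑[ v < n ] 𝟙 (u ~′? v) + ∑[ v < n ] 𝟙 ((u , v) ≈ₑ? (x , y))
      ≡⟨ ∑-distrib-+ {n} _ _ ⟨
    ∑[ v < n ] (𝟙 (u ~′? v) + 𝟙 ((u , v) ≈ₑ? (x , y)))
      ≡⟨ sum-cong-≗ (slide-𝟙 u) ⟩
    ∑[ v < n ] (𝟙 (u ~? v) + 𝟙 ((u , v) ≈ₑ? (x , z)))
      ≡⟨ ∑-distrib-+ {n} _ _ ⟩
    ∑[ v < n ] 𝟙 (u ~? v) + ∑[ v < n ] 𝟙 ((u , v) ≈ₑ? (x , z))
      ≡⟨ cong₂ _+_ (sym (degree≡∑ Γ u)) (∑-𝟙-≈ₑ x≢z u) ⟩
    deg u + (𝟙 (u ≟ x) + 𝟙 (u ≟ z))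
      ≡⟨ rearrange (𝟙 (u ≟ x)) (deg u) _ ⟨
    𝟙 (u ≟ x) + (deg u + 𝟙 (u ≟ z)) ∎)
    where
    open ≡-Reasoning
    rearrange : ∀ a b c → a + (b + c) ≡ b + (a + c)
    rearrange = solve-∀

  slide-degree-source : suc (degree′ y) ≡ deg y
  slide-degree-source = begin
    suc (degree′ y)         ≡⟨ +-comm 1 _ ⟩
    degree′ y + 1           ≡⟨ cong (degree′ y +_) (𝟙-true (y ≟ y) refl) ⟨
    degree′ y + 𝟙 (y ≟ y)   ≡⟨ slide-degree y ⟩
    deg y + 𝟙 (y ≟ z)    ≡⟨ cong (deg y +_) (𝟙-false (y ≟ z) (~⇒≢ y~z)) ⟩
    deg y + 0            ≡⟨ +-identityʳ _ ⟩
    deg y                ∎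
    where open ≡-Reasoning

  slide-degree-target : degree′ z ≡ suc (deg z)
  slide-degree-target = begin
    degree′ z               ≡⟨ +-identityʳ _ ⟨
    degree′ z + 0           ≡⟨ cong (degree′ z +_) (𝟙-false (z ≟ y) (~⇒≢ y~z ∘ sym)) ⟨
    degree′ z + 𝟙 (z ≟ y)   ≡⟨ slide-degree z ⟩
    deg z + 𝟙 (z ≟ z)    ≡⟨ cong (deg z +_) (𝟙-true (z ≟ z) refl) ⟩
    deg z + 1            ≡⟨ +-comm _ 1 ⟩
    suc (deg z)          ∎
    where open ≡-Reasoning

  slide-degree-other : ∀ {u} → u ≢ y → u ≢ z → degree′ u ≡ deg u
  slide-degree-other {u} u≢y u≢z = +-cancelʳ-≡ 0 _ _ (begin
    degree′ u + 0           ≡⟨ cong (degree′ u +_) (𝟙-false (u ≟ y) u≢y) ⟨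
    degree′ u + 𝟙 (u ≟ y)   ≡⟨ slide-degree u ⟩
    deg u + 𝟙 (u ≟ z)    ≡⟨ cong (deg u +_) (𝟙-false (u ≟ z) u≢z) ⟩
    deg u + 0            ∎)
    where open ≡-Reasoning

  -- The pointwise squares of slide-degree, summed up; the indicators are
  -- idempotent and pick out one vertex each.
  slide-potential : potential Γ′ + 2 * degree′ y ≡ potential Γ + 2 * deg z
  slide-potential = suc-injective (begin
    suc (potential Γ′ + 2 * degree′ y) ≡⟨ expand-sum Γ′ y ⟨
    ∑[ u < n ] ((degree′ u + 𝟙 (u ≟ y)) * (degree′ u + 𝟙 (u ≟ y)))
      ≡⟨ sum-cong-≗ (λ u → cong (λ d → d * d) (slide-degree u)) ⟩
    ∑[ u < n ] ((deg u + 𝟙 (u ≟ z)) * (deg u + 𝟙 (u ≟ z)))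
      ≡⟨ expand-sum Γ z ⟩
    suc (potential Γ + 2 * deg z) ∎)
    where
    open ≡-Reasoning

    square : ∀ {P : Set} (P? : Dec P) d → (d + 𝟙 P?) * (d + 𝟙 P?) ≡ d * d + 𝟙 P? * suc (2 * d)
    square (yes _) = solve-yes
      where
      solve-yes : ∀ d → (d + 1) * (d + 1) ≡ d * d + 1 * suc (2 * d)
      solve-yes = solve-∀
    square (no _)  = solve-no
      where
      solve-no : ∀ d → (d + 0) * (d + 0) ≡ d * d + 0
      solve-no = solve-∀

    expand-sum : ∀ (Δ : Graph n) w (let d = Graph.degree Δ) →
      ∑[ u < n ] ((d u + 𝟙 (u ≟ w)) * (d u + 𝟙 (u ≟ w))) ≡ suc (potential Δ + 2 * d w)
    expand-sum Δ w = begin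
      ∑[ u < n ] ((d u + 𝟙 (u ≟ w)) * (d u + 𝟙 (u ≟ w)))
        ≡⟨ sum-cong-≗ (λ u → square (u ≟ w) (d u)) ⟩
      ∑[ u < n ] (d u * d u + 𝟙 (u ≟ w) * suc (2 * d u))
        ≡⟨ ∑-distrib-+ {n} _ _ ⟩
      potential Δ + ∑[ u < n ] (𝟙 (u ≟ w) * suc (2 * d u))
        ≡⟨ cong (potential Δ +_) (∑-𝟙-* w _) ⟩
      potential Δ + suc (2 * d w)
        ≡⟨ +-suc (potential Δ) _ ⟩
      suc (potential Δ + 2 * d w) ∎
      where d = Graph.degree Δ

  -- With `degree′ y` one less than `deg y`, the potential changes by twice `deg z + 1 - deg y`:
  -- negative for a gap of at least 2, zero for a gap of 1.
  slide-potential-< : 2 + deg z ≤ deg y → potential Γ′ < potential Γ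
  slide-potential-< 2+dz≤dy = +-cancelʳ-< (2 * degree′ y) _ _ (begin-strict
    potential Γ′ + 2 * degree′ y ≡⟨ slide-potential ⟩
    potential Γ + 2 * deg z   <⟨ +-monoʳ-< (potential Γ) (*-monoʳ-< 2 dz<d′y) ⟩
    potential Γ + 2 * degree′ y  ∎)
    where
    open ≤-Reasoning
    dz<d′y : deg z < degree′ y
    dz<d′y = s≤s⁻¹ (subst (2 + deg z ≤_) (sym slide-degree-source) 2+dz≤dy)

  slide-potential-≡ : deg y ≡ suc (deg z) → potential Γ′ ≡ potential Γ
  slide-potential-≡ dy≡1+dz = +-cancelʳ-≡ (2 * degree′ y) _ _
    (trans slide-potential (cong (λ d → potential Γ + 2 * d) (sym d′y≡dz)))
    where
    d′y≡dz : degree′ y ≡ deg z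
    d′y≡dz = suc-injective (trans slide-degree-source dy≡1+dz)

-- Lowering the potential along a walk.

-- Several slides are allowed because potential-preserving ones may precede the decreasing one.
-- Connectedness is recorded so that the descent can continue from `Δ`.
Improvement : ∀ {n} → Graph n → Set₁
Improvement {n} Γ = Σ[ Δ ∈ Graph n ] (Star Slide Γ Δ × Connected Δ × potential Δ < potential Γ)

-- Recursion is on the length bound `k`, because the graph itself may change; every recursive call
-- keeps the potential and a gap of at least 2 to `z`.
improve : ∀ {n} k (Γ : Graph n) → Connected Γ → ∀ {y z} → Walk Γ k y z →
          2 + degree Γ z ≤ degree Γ y → Improvement Γ
improve k Γ conn {y} [] gap = contradiction (≤-trans (m≤n+m _ 1) gap) 1+n≰n
improve (suc k) Γ conn {y} {z} (_∷_ {v = v} y~v p) gap with degree Γ y ≤? degree Γ v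
... | yes dy≤dv = improve k Γ conn p (≤-trans gap dy≤dv)
... | no dy≰dv with private-neighbour Γ y~v (≰⇒> dy≰dv)
...   | x , x~y , x≢v , x≁v with 2 + degree Γ v ≤? degree Γ y
...     | yes gap′ = slide Γ x y v x≢v , slide-slides Γ x~y y~v x≢v x≁v ◅ ε
                   , slide-connected Γ x~y y~v x≢v x≁v conn , slide-potential-< Γ x~y y~v x≢v x≁v gap′
...     | no ¬gap′ with slide-walk Γ x~y y~v x≢v x≁v p
-- The walk returns to `y`: drop the detour and stay in `Γ`, without sliding.
...       | inj₁ q = improve k Γ conn q gap
-- The rest of the walk avoids `y` and survives the slide. Now `v` has the former degree of `y`,
-- while `z`, distinct from both, keeps its own.
...       | inj₂ (_ , q) =
  let Δ , slides , conn-Δ , Δ<Γ′ = improve k Γ′ (slide-connected Γ x~y y~v x≢v x≁v conn) q gap-Γ′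
  in Δ , slide-slides Γ x~y y~v x≢v x≁v ◅ slides , conn-Δ
   , subst (potential Δ <_) (slide-potential-≡ Γ x~y y~v x≢v x≁v dy≡1+dv) Δ<Γ′
  where
  Γ′ = slide Γ x y v x≢v

  dy≡1+dv : degree Γ y ≡ suc (degree Γ v)
  dy≡1+dv = ≤-antisym (s≤s⁻¹ (≰⇒> ¬gap′)) (≰⇒> dy≰dv)

  z≢y : z ≢ y
  z≢y refl = contradiction (≤-trans (m≤n+m _ 1) gap) 1+n≰n

  z≢v : z ≢ v
  z≢v refl = ¬gap′ gap

  gap-Γ′ : 2 + degree Γ′ z ≤ degree Γ′ v
  gap-Γ′ = begin
    2 + degree Γ′ z  ≡⟨ cong (2 +_) (slide-degree-other Γ x~y y~v x≢v x≁v z≢y z≢v) ⟩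
    2 + degree Γ z   ≤⟨ gap ⟩
    degree Γ y       ≡⟨ dy≡1+dv ⟩
    suc (degree Γ v) ≡⟨ slide-degree-target Γ x~y y~v x≢v x≁v ⟨
    degree Γ′ v      ∎
    where open ≤-Reasoning

-- Descent to an almost regular graph.

∣-∣≤1 : ∀ {a b} → a ≤ suc b → b ≤ suc a → ∣ a - b ∣ ≤ 1
∣-∣≤1 {zero}        {_}     _         b≤1       = b≤1
∣-∣≤1 {suc a}       {zero}  a≤1       _         = a≤1
∣-∣≤1 {suc a}       {suc b} (s≤s a≤)  (s≤s b≤)  = ∣-∣≤1 a≤ b≤

almostRegular⊎gap : ∀ {n} (Γ : Graph n) →
  AlmostRegular Γ ⊎ (∃[ y ] ∃[ z ] 2 + degree Γ z ≤ degree Γ y)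
almostRegular⊎gap Γ with any? (λ y → any? (λ z → 2 + degree Γ z ≤? degree Γ y))
... | yes gap = inj₂ gap
... | no none = inj₁ (λ x y → ∣-∣≤1 (close x y) (close y x))
  where
  close : ∀ x y → degree Γ x ≤ suc (degree Γ y)
  close x y = s≤s⁻¹ (≰⇒> (λ gap → none (x , y , gap)))

-- While some gap is at least 2, connectedness supplies a walk between its ends and `improve` lowers
-- the potential; well-foundedness of `_<_` ends the process.
regularize : ∀ {n} (Γ : Graph n) → Connected Γ → Acc _<_ (potential Γ) →
             Σ[ Δ ∈ Graph n ] (Star Slide Γ Δ × AlmostRegular Δ)
regularize Γ conn (acc smaller) with almostRegular⊎gap Γ
... | inj₁ regular       = Γ , ε , regular
... | inj₂ (y , z , gap) =
  let k , walk = fromStar (conn y z)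
      Γ′ , slides , conn′ , Γ′<Γ = improve k Γ conn walk gap
      Δ , slides′ , regular = regularize Γ′ conn′ (smaller Γ′<Γ)
  in Δ , slides ◅◅ slides′ , regular

Isomorphic-refl : ∀ {n} (Γ : Graph n) → Isomorphic Γ Γ
Isomorphic-refl Γ = record { bijection = ↔-id _ ; preserves = λ x y → ⇔-id _ }

theorem4p2 : ∀ {n : ℕ} (Γ : Graph n) → Connected Γ →
    Σ[ m ∈ ℕ ] Σ[ Δ ∈ Graph m ] (SlideEquivalent Γ Δ × AlmostRegular Δ)
theorem4p2 {n} Γ conn =
  let Δ , slides , regular = regularize Γ conn (<-wellFounded (potential Γ))
  in n , Δ , (Δ , slides , Isomorphic-refl Δ) , regular
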